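{- Let $M$ be an $n\times n$ binary matrix that is indecomposable, with period $d$ and index $\gamma$, and let $P$ be the level poset of $M$. For an integer $p\ge 1$ consider the condition $$(E_p)\qquad \sum_{i=0}^{p} (-1)^{i}\, \operatorname{Bin}(M^{i})\cdot \operatorname{Bin}(M^{p-i}) = 0 .$$ Then $P$ is a level Eulerian poset if and only if $(E_p)$ holds for all $1\le p<2\gamma+4d$. If $d$ is odd, the bound may be improved: $P$ is level Eulerian if and only if $(E_p)$ holds for all $1\le p<2\gamma+2d$.
   Context: For a square matrix $A$ with nonnegative entries, $\operatorname{Bin}(A)$ is the $0/1$ matrix obtained by replacing each nonzero entry of $A$ by $1$; $A^0=I$. Level poset of a binary matrix: let $M$ be a $0/1$ square matrix with rows and columns indexed by a finite nonempty set $V$. The level poset of $M$ is the poset on $V\times\mathbb{Z}$ with $(u,i)<(v,j)$ if and only if $i<j$ and $(M^{j-i})_{u,v}>0$; the projection onto the second coordinate is its rank function, and $M$ is the adjacency matrix of its underlying digraph (edges $u\to v$ when $M_{u,v}=1$). A finite graded poset (with minimum, maximum and rank function $\rho$) is Eulerian if every interval $[x,y]$ in it of rank at least $1$ satisfies $\sum_{x\le z\le y}(-1)^{\rho(z)}=0$. A level poset is level Eulerian if every one of its intervals is Eulerian. A nonnegative square matrix $M$ is indecomposable if for all $i,j$ there is $t>0$ with $(M^t)_{i,j}>0$. Its period $d$ is the greatest common divisor of all positive integers $k$ with $(M^k)_{i,i}>0$ (independent of $i$). Its index $\gamma$ is the smallest nonnegative integer such that $\operatorname{Bin}(M^{t+d})=\operatorname{Bin}(M^{t})$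 for all $t\ge\gamma$.
   Formalization: The improved bound for odd d is stated only for n ≠ 1: for n = 1 and M = (1), one has d = 1 and γ = 0, and (E_1) holds, but the level poset is the chain of integers, whose rank-2 intervals have alternating sum 1. -}

module Defs where

open import Algebra.Properties.Monoid.Sum using (sum-syntax)
open import Data.Bool.Base using (if_then_else_)
open import Data.Fin.Base using (Fin; zero; suc; toℕ)
import Data.Fin.Properties as Fin
open import Data.Integer.Base as ℤ using (ℤ; +_; ∣_∣; 0ℤ; 1ℤ; -1ℤ)
import Data.Integer.Properties as ℤ
open import Data.List.Base using (List; foldr; map)
import Data.List.Membership.Setoid as Membership
open import Data.List.Relation.Unary.Enumerates.Setoid using (IsEnumeration)
open import Data.List.Relation.Unary.Unique.Setoid using (Unique)
open import Data.Nat.Base as ℕ using (ℕ; zero; suc; _+_; _*_; _∸_; _≤_; _<_; z≤n; s≤s)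
open import Data.Nat.Divisibility using (_∣_)
import Data.Nat.Properties as ℕ
open import Data.Product.Base using (∃; _×_; _,_; proj₁; proj₂)
open import Data.Sum.Base using (_⊎_; inj₁; inj₂)
open import Function.Base using (_∘_)
open import Function.Bundles using (_⇔_)
open import Level using (Level; _⊔_; 0ℓ)
open import Relation.Binary.Bundles using (Poset; StrictPartialOrder)
open import Relation.Binary.Core using (_Preserves_⟶_)
import Relation.Binary.Construct.NonStrictToStrict as ToStrict
import Relation.Binary.Construct.On as On
open import Relation.Binary.Definitions using (Minimum; Maximum)
import Relation.Binary.Properties.StrictPartialOrder as SPO
open import Relation.Binary.PropositionalEquality
open import Relation.Nullary.Decidable using (does; yes)
open import Relation.Nullary.Negation using (¬_)
open import Relation.Unary using (Pred)

private
  variable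
    a ℓ₁ ℓ₂ p : Level
    n : ℕ

sumℕ : (Fin n → ℕ) → ℕ
sumℕ {n} f = sum-syntax ℕ.+-0-monoid n f

sumℤ : (Fin n → ℤ) → ℤ
sumℤ {n} f = sum-syntax ℤ.+-0-monoid n f

------------------------------------------------------------------------
-- Nonnegative integer matrices

Matrix : ℕ → Set
Matrix n = Fin n → Fin n → ℕ

infix 4 _≈ᴹ_
infixl 7 _·_
infixr 8 _^_

_≈ᴹ_ : Matrix n → Matrix n → Set
A ≈ᴹ B = ∀ i j → A i j ≡ B i j

I : Matrix n
I i j = if does (i Fin.≟ j) then 1 else 0

_·_ : Matrix n → Matrix n → Matrix n
(A · B) i j = sumℕ (λ k → A i k * B k j)

_^_ : Matrix n → ℕ → Matrix n
A ^ zero  = I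
A ^ suc k = A · A ^ k

bin : ℕ → ℕ
bin zero    = 0
bin (suc _) = 1

Bin : Matrix n → Matrix n
Bin A i j = bin (A i j)

IsBinary : Matrix n → Set
IsBinary M = ∀ i j → M i j ≡ 0 ⊎ M i j ≡ 1

Indecomposable : Matrix n → Set
Indecomposable M = ∀ i j → ∃ λ t → 0 < t × 0 < (M ^ t) i j

-- The gcd of a possibly infinite set of natural numbers; as for Data.Nat.GCD.GCD,
-- "greatest" refers to the divisibility order.
IsGCDOf : Pred ℕ p → ℕ → Set p
IsGCDOf S d = (∀ k → S k → d ∣ k) × (∀ e → (∀ k → S k → e ∣ k) → e ∣ d)

-- For indecomposable M the gcd does not depend on i, so asking for one i is the
-- same as asking for all of them; no independence is assumed by this form.
IsPeriod : Matrix n → ℕ → Set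
IsPeriod M d = ∃ λ i → IsGCDOf (λ k → 0 < k × 0 < (M ^ k) i i) d

PeriodicFrom : Matrix n → ℕ → ℕ → Set
PeriodicFrom M d γ = ∀ t → γ ≤ t → Bin (M ^ (t + d)) ≈ᴹ Bin (M ^ t)

IsIndex : Matrix n → ℕ → ℕ → Set
IsIndex M d γ = PeriodicFrom M d γ × (∀ γ′ → PeriodicFrom M d γ′ → γ ≤ γ′)

-- The products are formed over ℕ and cast to ℤ entrywise for the alternating sum.
E : Matrix n → ℕ → Set
E M p = ∀ u v →
  sumℤ {suc p} (λ i → (-1ℤ ℤ.^ toℕ i) ℤ.* + (Bin (M ^ toℕ i) · Bin (M ^ (p ∸ toℕ i))) u v) ≡ 0ℤ

------------------------------------------------------------------------
-- Eulerian posets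

-- ∣ k ∣ has the parity of k, so this is (-1)^k for an arbitrary integer k.
sign : ℤ → ℤ
sign k = -1ℤ ℤ.^ ∣ k ∣

-- The rank function is integer-valued and not normalised at the minimum:
-- shifting it by a constant at most negates all alternating sums, so it does
-- not affect IsEulerian.
module _ (P : Poset a ℓ₁ ℓ₂) (rank : Poset.Carrier P → ℤ) where
  open Poset P renaming (_≤_ to _≼_)
  open Membership Eq.setoid using (_∈_)
  open ToStrict _≈_ _≼_ renaming (_<_ to _≺_) using ()

  _⋖_ : Carrier → Carrier → Set (a ⊔ ℓ₁ ⊔ ℓ₂)
  x ⋖ y = x ≺ y × ¬ (∃ λ z → x ≺ z × z ≺ y)

  record IsRankFunction : Set (a ⊔ ℓ₁ ⊔ ℓ₂) where
    field
      rank-cong : rank Preserves _≈_ ⟶ _≡_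
      rank-mono : rank Preserves _≺_ ⟶ ℤ._<_
      rank-⋖    : ∀ {x y} → x ⋖ y → rank y ≡ ℤ.suc (rank x)

  ListsInterval : Carrier → Carrier → List Carrier → Set (a ⊔ ℓ₁ ⊔ ℓ₂)
  ListsInterval x y zs = Unique Eq.setoid zs × (∀ z → z ∈ zs ⇔ (x ≼ z × z ≼ y))

  alternatingSum : List Carrier → ℤ
  alternatingSum zs = foldr ℤ._+_ 0ℤ (map (sign ∘ rank) zs)

  record IsEulerian : Set (a ⊔ ℓ₁ ⊔ ℓ₂) where
    field
      finite         : ∃ (IsEnumeration Eq.setoid)
      minimum        : ∃ (Minimum _≼_)
      maximum        : ∃ (Maximum _≼_)
      isRankFunction : IsRankFunction
      eulerian       : ∀ x y → x ≼ y → 1ℤ ℤ.≤ rank y ℤ.- rank x →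
                       ∃ λ zs → ListsInterval x y zs × alternatingSum zs ≡ 0ℤ

intervalPoset : (P : Poset a ℓ₁ ℓ₂) (x y : Poset.Carrier P) → Poset (a ⊔ ℓ₂) ℓ₁ ℓ₂
intervalPoset P x y = On.poset {B = ∃ λ z → x ≼ z × z ≼ y} P proj₁
  where open Poset P renaming (_≤_ to _≼_)

------------------------------------------------------------------------
-- Level posets

module _ (M : Matrix n) where

  infix 4 _⊏_

  -- The exponent is j - i, a positive integer since i < j.
  _⊏_ : Fin n × ℤ → Fin n × ℤ → Set
  (u , i) ⊏ (v , j) = i ℤ.< j × 0 < (M ^ ∣ j ℤ.- i ∣) u v

sum-pos⁺ : (f : Fin n → ℕ) (k : Fin n) → 0 < f k → 0 < sumℕ f
sum-pos⁺ f zero    q = ℕ.≤-trans q (ℕ.m≤m+n _ _)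
sum-pos⁺ f (suc k) q = ℕ.≤-trans (sum-pos⁺ (f ∘ suc) k q) (ℕ.m≤n+m _ (f zero))

sum-pos⁻ : (f : Fin n → ℕ) → 0 < sumℕ f → ∃ λ k → 0 < f k
sum-pos⁻ {suc n} f q with f zero in eq
... | suc m = zero , subst (0 <_) (sym eq) (s≤s z≤n)
... | zero  with k , r ← sum-pos⁻ (f ∘ suc) q = suc k , r

*-pos⁺ : ∀ {x y} → 0 < x → 0 < y → 0 < x * y
*-pos⁺ {suc x} {suc y} _ _ = s≤s z≤n

*-pos⁻ : ∀ x y → 0 < x * y → 0 < x × 0 < y
*-pos⁻ (suc x) (suc y) _ = s≤s z≤n , s≤s z≤n
*-pos⁻ (suc x) zero    q with () ← subst (0 <_) (ℕ.*-zeroʳ x) q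

I-pos : ∀ (u v : Fin n) → 0 < I u v → u ≡ v
I-pos u v q with u Fin.≟ v
... | yes u≡v = u≡v

^-pos-+ : ∀ (M : Matrix n) k l u v w → 0 < (M ^ k) u v → 0 < (M ^ l) v w → 0 < (M ^ (k + l)) u w
^-pos-+ M zero    l u v w q r rewrite I-pos u v q = r
^-pos-+ M (suc k) l u v w q r
  with x , s ← sum-pos⁻ (λ x → M u x * (M ^ k) x v) q
  with s₁ , s₂ ← *-pos⁻ (M u x) _ s
  = sum-pos⁺ (λ x → M u x * (M ^ (k + l)) x w) x (*-pos⁺ s₁ (^-pos-+ M k l x v w s₂ r))

∣-∣-+ : ∀ {i j k} → i ℤ.< j → j ℤ.< k → ∣ j ℤ.- i ∣ + ∣ k ℤ.- j ∣ ≡ ∣ k ℤ.- i ∣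
∣-∣-+ {i} {j} {k} i<j j<k = ℤ.+-injective (begin
  + ∣ j ℤ.- i ∣ ℤ.+ + ∣ k ℤ.- j ∣  ≡⟨ cong₂ ℤ._+_ (pos i<j) (pos j<k) ⟩
  (j ℤ.- i) ℤ.+ (k ℤ.- j)          ≡⟨ ℤ.+-comm (j ℤ.- i) (k ℤ.- j) ⟩
  (k ℤ.- j) ℤ.+ (j ℤ.- i)          ≡⟨ ℤ.+-minus-telescope k j i ⟩
  k ℤ.- i                          ≡⟨ pos (ℤ.<-trans i<j j<k) ⟨
  + ∣ k ℤ.- i ∣                    ∎)
  where
  open ≡-Reasoning
  pos : ∀ {x y} → x ℤ.< y → + ∣ y ℤ.- x ∣ ≡ y ℤ.- x
  pos x<y = ℤ.0≤i⇒+∣i∣≡i (ℤ.i≤j⇒0≤j-i (ℤ.<⇒≤ x<y))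

module _ (M : Matrix n) where

  levelStrictPartialOrder : StrictPartialOrder 0ℓ 0ℓ 0ℓ
  levelStrictPartialOrder = record
    { Carrier = Fin n × ℤ
    ; _≈_     = _≡_
    ; _<_     = _⊏_ M
    ; isStrictPartialOrder = record
      { isEquivalence = isEquivalence
      ; irrefl        = λ { refl (i<i , _) → ℤ.<-irrefl refl i<i }
      ; trans         = λ {x} {y} {z} → ⊏-trans x y z
      ; <-resp-≈      = resp₂ (_⊏_ M)
      }
    }
    where
    ⊏-trans : ∀ x y z → _⊏_ M x y → _⊏_ M y z → _⊏_ M x z
    ⊏-trans (u , i) (v , j) (w , k) (i<j , q) (j<k , r) =
      ℤ.<-trans i<j j<k ,
      subst (λ e → 0 < (M ^ e) u w) (∣-∣-+ i<j j<k) (^-pos-+ M ∣ j ℤ.- i ∣ ∣ k ℤ.- j ∣ u v w q r)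

  levelPoset : Poset 0ℓ 0ℓ 0ℓ
  levelPoset = SPO.poset levelStrictPartialOrder

  level : Fin n × ℤ → ℤ
  level = proj₂

  LevelEulerian : Set
  LevelEulerian = ∀ x y → x ≼ y → IsEulerian (intervalPoset levelPoset x y) (level ∘ proj₁)
    where open Poset levelPoset renaming (_≤_ to _≼_)

{-# OPTIONS --safe #-}
module Submission where

-- Summing over [(u, i), (v, i + p)] level by level, the alternating sum is,
-- up to sign, the (u, v) entry F p of the left-hand side of E p; hence the level poset is Eulerian
-- iff E p holds for every p ≥ 1.  For p ≥ 2γ, cut the sum F (p + 2d) after its first γ terms and
-- again 2d terms later: by periodicity the outer blocks make up F p, while the middle block only
-- depends on p modulo 2d.  Thus F (p + 4d) − F (p + 2d) = F (p + 2d) − F p.  For odd d the middle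
-- block is 0, because i and i + d have opposite signs, so F (p + 2d) = F p.  The recursions would
-- start at p = 0 when γ = 0, but then M is a permutation matrix and E 2 fails.

open import Defs
open import Algebra.Properties.Semiring.Sum using (*-distribˡ-sum)
open import Algebra.Properties.Monoid.Sum using (sum-cong-≗; sum-replicate-zero)
open import Data.Bool.Base using (if_then_else_)
open import Data.Fin.Base using (Fin; zero; suc; toℕ; fromℕ<)
import Data.Fin.Properties as Fin
open import Data.Integer.Base as ℤ using (ℤ; +_; -[1+_]; ∣_∣; 0ℤ; 1ℤ; -1ℤ)
import Data.Integer.Properties as ℤ
open import Data.List.Base using (List; []; _∷_; _++_; foldr; map; filter; tabulate; allFin; cartesianProductWith)
open import Data.List.Membership.Propositional using (_∈_)
open import Data.List.Membership.Propositional.Properties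
  using (∈-filter⁺; ∈-filter⁻; ∈-cartesianProductWith⁺; ∈-allFin; ∈-map⁻)
open import Data.List.Membership.Propositional.Properties.WithK using (unique∧set⇒bag)
open import Data.List.Properties using (map-∘)
open import Data.List.Relation.Binary.BagAndSetEquality using (∼bag⇒↭)
import Data.List.Relation.Binary.Permutation.Propositional.Properties as ↭
import Data.List.Relation.Binary.Permutation.Setoid.Properties as ↭ₛ
open import Data.List.Relation.Binary.Permutation.Propositional using (↭⇒↭ₛ)
open import Data.List.Relation.Unary.All as All using (All; []; _∷_)
import Data.List.Relation.Unary.AllPairs.Properties as AllPairs
import Data.List.Relation.Unary.Any.Properties as Any
open import Data.List.Relation.Unary.Unique.Propositional using (Unique)
import Data.List.Relation.Unary.Unique.Propositional.Properties as Unique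
open import Data.Nat.Base using (ℕ; zero; suc; NonZero; _+_; _*_; _∸_; _≤_; _<_; z≤n; s≤s)
open import Data.Nat.Divisibility using (_∣_; ∣-refl; ∣m∣n⇒∣m+n; 0∣⇒≡0; _∣0)
open import Data.Nat.Induction using (<-rec)
import Data.Nat.Properties as ℕ
open import Data.Nat.Solver using (module +-*-Solver)
open import Data.Product.Base using (∃; _×_; _,_; proj₁; proj₂)
open import Data.Product.Properties using (,-injective; ≡-dec)
open import Data.Sum.Base using (inj₁; inj₂)
open import Function.Base using (_∘_; id)
open import Function.Bundles using (_⇔_; mk⇔; Equivalence)
open import Level using (0ℓ)
open import Relation.Binary.Bundles using (Poset)
open import Relation.Binary.PropositionalEquality
open import Relation.Nullary.Decidable using (Dec; does; yes; no; _×-dec_; _⊎-dec_)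
open import Relation.Nullary.Negation using (¬_; contradiction)
open import Relation.Unary using (Pred; Decidable)

private
  variable
    n : ℕ

-- Alternating sums

Σ< : ℕ → (ℕ → ℤ) → ℤ
Σ< m f = sumℤ {m} (f ∘ toℕ)

Σ<-cong : ∀ m {f g : ℕ → ℤ} → (∀ i → i < m → f i ≡ g i) → Σ< m f ≡ Σ< m g
Σ<-cong m f≗g = sum-cong-≗ ℤ.+-0-monoid {m} (λ i → f≗g (toℕ i) (Fin.toℕ<n i))

Σ<-+ : ∀ m k f → Σ< (m + k) f ≡ Σ< m f ℤ.+ Σ< k (λ i → f (m + i))
Σ<-+ zero    k f = sym (ℤ.+-identityˡ _)
Σ<-+ (suc m) k f = trans (cong (ℤ._+_ (f 0)) (Σ<-+ m k (f ∘ suc))) (sym (ℤ.+-assoc (f 0) _ _))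

Σ<-neg : ∀ m f → Σ< m (λ i → ℤ.- f i) ≡ ℤ.- Σ< m f
Σ<-neg zero    f = refl
Σ<-neg (suc m) f = trans (cong (ℤ._+_ (ℤ.- f 0)) (Σ<-neg m (f ∘ suc))) (sym (ℤ.neg-distrib-+ (f 0) _))

-1^[n+n]≡1 : ∀ n → -1ℤ ℤ.^ (n + n) ≡ 1ℤ
-1^[n+n]≡1 zero    = refl
-1^[n+n]≡1 (suc n) rewrite ℕ.+-suc n n | -1^[n+n]≡1 n = refl

-1^odd≡-1 : ∀ n → ¬ 2 ∣ n → -1ℤ ℤ.^ n ≡ -1ℤ
-1^odd≡-1 zero          odd = contradiction (2 ∣0) odd
-1^odd≡-1 (suc zero)    odd = refl
-1^odd≡-1 (suc (suc n)) odd rewrite -1^odd≡-1 n (odd ∘ ∣m∣n⇒∣m+n ∣-refl) = refl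

-- Every `r ≥ b + k` has the form `p + k` with `p ≥ b`, so the base cases are exactly
-- `1 ≤ p < b + k`. With `b = 2γ`, the shifts `k = 4d` and `k = 2d` give the two bounds of the
-- theorem. The step sees all smaller positive values because the recursion for general `d` looks
-- back at two of them.
stepInduction : ∀ (P : ℕ → Set) b k →
                (∀ p → b ≤ p → (∀ q → 1 ≤ q → q < p + k → P q) → P (p + k)) →
                (∀ p → 1 ≤ p → p < b + k → P p) → ∀ p → 1 ≤ p → P p
stepInduction P b k step base = <-rec (λ p → 1 ≤ p → P p) go
  where
  go : ∀ p → (∀ {q} → q < p → 1 ≤ q → P q) → 1 ≤ p → P p
  go p rec 1≤p with p ℕ.<? b + k
  ... | yes p<b+k = base p 1≤p p<b+k
  ... | no  p≮b+k = subst P p∸k+k≡p (step (p ∸ k) (ℕ.m+n≤o⇒m≤o∸n b b+k≤p)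
                      λ q 1≤q q<p → rec (subst (q <_) p∸k+k≡p q<p) 1≤q)
    where
    b+k≤p : b + k ≤ p
    b+k≤p = ℕ.≮⇒≥ p≮b+k
    p∸k+k≡p : p ∸ k + k ≡ p
    p∸k+k≡p = ℕ.m∸n+n≡m (ℕ.m+n≤o⇒n≤o b b+k≤p)

-- Convolutions of eventually periodic families

module AlternatingConvolution (f : ℕ → ℕ → ℤ) (γ : ℕ) where

  -- Each argument is periodic from `γ` on whatever the other one is. This is the behaviour in `i`
  -- and `j` of a fixed entry of `Bin (M ^ i) · Bin (M ^ j)`.
  PeriodicInBoth : ℕ → Set
  PeriodicInBoth e = (∀ i j → γ ≤ i → f (i + e) j ≡ f i j) × (∀ i j → γ ≤ j → f i (j + e) ≡ f i j)

  term : ℕ → ℕ → ℤ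
  term p i = -1ℤ ℤ.^ i ℤ.* f i (p ∸ i)

  F : ℕ → ℤ
  F p = Σ< (suc p) (term p)

  -- With `i` fixed, the sign stays and the whole increase goes into the second argument, which is
  -- already at least `γ`.
  term-right : ∀ {e} → PeriodicInBoth e → ∀ p i → i + γ ≤ p → term (p + e) i ≡ term p i
  term-right {e} (_ , right) p i i+γ≤p = cong (-1ℤ ℤ.^ i ℤ.*_) (begin
    f i (p + e ∸ i)    ≡⟨ cong (f i) (ℕ.+-∸-comm e (ℕ.m+n≤o⇒m≤o i i+γ≤p)) ⟩
    f i ((p ∸ i) + e)  ≡⟨ right i (p ∸ i) (ℕ.m+n≤o⇒m≤o∸n γ (subst (_≤ p) (ℕ.+-comm i γ) i+γ≤p)) ⟩
    f i (p ∸ i)        ∎)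
    where open ≡-Reasoning

  -- Moving `p` and `i` together keeps the second argument, also where the subtraction truncates, so
  -- no bound on `p` is required; only the sign picks up a factor.
  term-left : ∀ {e} → PeriodicInBoth e → ∀ p i → γ ≤ i → term (p + e) (i + e) ≡ -1ℤ ℤ.^ e ℤ.* term p i
  term-left {e} (left , _) p i γ≤i = begin
    -1ℤ ℤ.^ (i + e) ℤ.* f (i + e) (p + e ∸ (i + e))
      ≡⟨ cong (λ j → -1ℤ ℤ.^ (i + e) ℤ.* f (i + e) j)
           (trans (cong₂ _∸_ (ℕ.+-comm p e) (ℕ.+-comm i e)) (ℕ.[m+n]∸[m+o]≡n∸o e p i)) ⟩
    -1ℤ ℤ.^ (i + e) ℤ.* f (i + e) (p ∸ i)
      ≡⟨ cong₂ ℤ._*_ (trans (cong (-1ℤ ℤ.^_) (ℕ.+-comm i e)) (ℤ.^-distribˡ-+-* -1ℤ e i)) (left i (p ∸ i) γ≤i) ⟩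
    -1ℤ ℤ.^ e ℤ.* -1ℤ ℤ.^ i ℤ.* f i (p ∸ i)
      ≡⟨ ℤ.*-assoc (-1ℤ ℤ.^ e) _ _ ⟩
    -1ℤ ℤ.^ e ℤ.* term p i  ∎
    where open ≡-Reasoning

  module _ {d : ℕ} (per : PeriodicInBoth d) where

    -- The shift `2d` makes the sign factor of `term-left` equal to 1 for either parity of `d`.
    double : PeriodicInBoth (d + d)
    double =
      (λ i j γ≤i → trans (cong (λ k → f k j) (sym (ℕ.+-assoc i d d)))
                  (trans (proj₁ per (i + d) j (ℕ.m≤n⇒m≤n+o d γ≤i)) (proj₁ per i j γ≤i))) ,
      (λ i j γ≤j → trans (cong (f i) (sym (ℕ.+-assoc j d d)))
                  (trans (proj₂ per i (j + d) (ℕ.m≤n⇒m≤n+o d γ≤j)) (proj₂ per i j γ≤j)))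

    mid : ℕ → ℤ
    mid p = Σ< (d + d) (λ i → term (p + (d + d)) (γ + i))

    -- The side condition of `term-right` inside the middle block: `k` is `2d` for the whole block
    -- and `d` for its first half.
    mid-bound : ∀ {p k i} → γ + γ ≤ p → i < k → γ + i + γ ≤ p + k
    mid-bound {p} {k} {i} 2γ≤p i<k = begin
      γ + i + γ    ≡⟨ solve 2 (λ g i → g :+ i :+ g := g :+ g :+ i) refl γ i ⟩
      γ + γ + i    ≤⟨ ℕ.+-mono-≤ 2γ≤p (ℕ.<⇒≤ i<k) ⟩
      p + k        ∎
      where
      open ℕ.≤-Reasoning
      open +-*-Solver

    mid-periodic : ∀ p → γ + γ ≤ p → mid (p + (d + d)) ≡ mid p
    mid-periodic p 2γ≤p = Σ<-cong (d + d) λ i i<2d →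
      term-right double (p + (d + d)) (γ + i) (mid-bound 2γ≤p i<2d)

    -- As `p ≥ 2γ`, the first `γ` terms have second argument at least `γ` before the shift, and
    -- `term-right` matches them with those of `F p`. The last `p + 1 - γ` terms come from indices
    -- at least `γ`, so `term-left` matches them with the rest of `F p`.
    F-step : ∀ p → γ + γ ≤ p → F (p + (d + d)) ≡ F p ℤ.+ mid p
    F-step p 2γ≤p = begin
      Σ< (suc (p + D)) (term (p + D))
        ≡⟨ cong (λ k → Σ< k (term (p + D))) length-eq ⟩
      Σ< (γ + (D + m)) (term (p + D))
        ≡⟨ Σ<-+ γ (D + m) (term (p + D)) ⟩
      Σ< γ (term (p + D)) ℤ.+ Σ< (D + m) (λ i → term (p + D) (γ + i))
        ≡⟨ cong₂ ℤ._+_ head (trans (Σ<-+ D m (λ i → term (p + D) (γ + i))) (cong (ℤ._+_ (mid p)) tail)) ⟩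
      Σ< γ (term p) ℤ.+ (mid p ℤ.+ Σ< m (λ i → term p (γ + i)))
        ≡⟨ cong (ℤ._+_ (Σ< γ (term p))) (ℤ.+-comm (mid p) _) ⟩
      Σ< γ (term p) ℤ.+ (Σ< m (λ i → term p (γ + i)) ℤ.+ mid p)
        ≡⟨ ℤ.+-assoc (Σ< γ (term p)) _ _ ⟨
      Σ< γ (term p) ℤ.+ Σ< m (λ i → term p (γ + i)) ℤ.+ mid p
        ≡⟨ cong (ℤ._+ mid p) (Σ<-+ γ m (term p)) ⟨
      Σ< (γ + m) (term p) ℤ.+ mid p
        ≡⟨ cong (λ k → Σ< k (term p) ℤ.+ mid p) γ+m≡1+p ⟩
      F p ℤ.+ mid p ∎
      where
      open ≡-Reasoning
      open +-*-Solver
      D m : ℕ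
      D = d + d
      m = suc p ∸ γ
      γ+m≡1+p : γ + m ≡ suc p
      γ+m≡1+p = ℕ.m+[n∸m]≡n (ℕ.m≤n⇒m≤1+n (ℕ.m+n≤o⇒m≤o γ 2γ≤p))
      length-eq : suc (p + D) ≡ γ + (D + m)
      length-eq = trans (cong (_+ D) (sym γ+m≡1+p))
        (solve 3 (λ g m D → g :+ m :+ D := g :+ (D :+ m)) refl γ m D)
      head : Σ< γ (term (p + D)) ≡ Σ< γ (term p)
      head = Σ<-cong γ λ i i<γ → term-right double p i (ℕ.≤-trans (ℕ.+-monoˡ-≤ γ (ℕ.<⇒≤ i<γ)) 2γ≤p)
      tail : Σ< m (λ i → term (p + D) (γ + (D + i))) ≡ Σ< m (λ i → term p (γ + i))
      tail = Σ<-cong m λ i _ → begin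
        term (p + D) (γ + (D + i))
          ≡⟨ cong (term (p + D)) (solve 3 (λ g D i → g :+ (D :+ i) := g :+ i :+ D) refl γ D i) ⟩
        term (p + D) (γ + i + D)
          ≡⟨ term-left double p (γ + i) (ℕ.m≤m+n γ i) ⟩
        -1ℤ ℤ.^ D ℤ.* term p (γ + i)
          ≡⟨ cong (ℤ._* term p (γ + i)) (-1^[n+n]≡1 d) ⟩
        1ℤ ℤ.* term p (γ + i)
          ≡⟨ ℤ.*-identityˡ _ ⟩
        term p (γ + i) ∎

    F-vanishes : ∀ p → γ + γ ≤ p → F p ≡ 0ℤ → F (p + (d + d)) ≡ 0ℤ → F (p + (d + d) + (d + d)) ≡ 0ℤ
    F-vanishes p 2γ≤p Fp≡0 Fp+2d≡0 = begin
      F (p + D + D)                ≡⟨ F-step (p + D) (ℕ.m≤n⇒m≤n+o D 2γ≤p) ⟩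
      F (p + D) ℤ.+ mid (p + D)    ≡⟨ cong₂ ℤ._+_ Fp+2d≡0 (mid-periodic p 2γ≤p) ⟩
      -- Putting `F p` back in place of 0 turns the expression into `F (p + 2d)`, which is 0 by
      -- hypothesis.
      0ℤ ℤ.+ mid p                 ≡⟨ cong (ℤ._+ mid p) Fp≡0 ⟨
      F p ℤ.+ mid p                ≡⟨ F-step p 2γ≤p ⟨
      F (p + D)                    ≡⟨ Fp+2d≡0 ⟩
      0ℤ ∎
      where
      open ≡-Reasoning
      D = d + d

    -- For odd d, the indices i and i + d contribute opposite terms to the middle block.
    mid-odd : ¬ 2 ∣ d → ∀ p → γ + γ ≤ p → mid p ≡ 0ℤ
    mid-odd odd p 2γ≤p = begin
      mid p
        -- Reading `2d` as two shifts by `d` lets both halves be reduced to terms of `F (p + d)`: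
        -- the first by `term-right`, the second by `term-left`.
        ≡⟨ cong (λ q → Σ< (d + d) (λ i → term q (γ + i))) (sym (ℕ.+-assoc p d d)) ⟩
      Σ< (d + d) (λ i → term (p + d + d) (γ + i))
        ≡⟨ Σ<-+ d d (λ i → term (p + d + d) (γ + i)) ⟩
      Σ< d (λ i → term (p + d + d) (γ + i)) ℤ.+ Σ< d (λ i → term (p + d + d) (γ + (d + i)))
        ≡⟨ cong₂ ℤ._+_
             (Σ<-cong d λ i i<d → term-right per (p + d) (γ + i) (mid-bound 2γ≤p i<d))
             (trans (Σ<-cong d second) (Σ<-neg d (λ i → term (p + d) (γ + i)))) ⟩
      S ℤ.+ ℤ.- S
        ≡⟨ ℤ.+-inverseʳ S ⟩
      0ℤ ∎
      where
      open ≡-Reasoning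
      open +-*-Solver
      S = Σ< d (λ i → term (p + d) (γ + i))
      second : ∀ i → i < d → term (p + d + d) (γ + (d + i)) ≡ ℤ.- term (p + d) (γ + i)
      second i _ = begin
        term (p + d + d) (γ + (d + i))
          ≡⟨ cong (term (p + d + d)) (solve 3 (λ g d i → g :+ (d :+ i) := g :+ i :+ d) refl γ d i) ⟩
        term (p + d + d) (γ + i + d)
          ≡⟨ term-left per (p + d) (γ + i) (ℕ.m≤m+n γ i) ⟩
        -1ℤ ℤ.^ d ℤ.* term (p + d) (γ + i)
          ≡⟨ cong (ℤ._* term (p + d) (γ + i)) (-1^odd≡-1 d odd) ⟩
        -1ℤ ℤ.* term (p + d) (γ + i)
          ≡⟨ ℤ.-1*i≡-i _ ⟩
        ℤ.- term (p + d) (γ + i) ∎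

    F-vanishes-odd : ¬ 2 ∣ d → ∀ p → γ + γ ≤ p → F p ≡ 0ℤ → F (p + (d + d)) ≡ 0ℤ
    F-vanishes-odd odd p 2γ≤p Fp≡0 = trans (F-step p 2γ≤p) (cong₂ ℤ._+_ Fp≡0 (mid-odd odd p 2γ≤p))

-- Walks

sum-single : ∀ (f : Fin n → ℕ) k → (∀ l → l ≢ k → f l ≡ 0) → sumℕ f ≡ f k
sum-single {suc n} f zero    f≡0 = trans (cong (_+_ (f zero)) (all-zero (f ∘ suc) λ l → f≡0 (suc l) λ ())) (ℕ.+-identityʳ _)
  where
  all-zero : ∀ {m} (g : Fin m → ℕ) → (∀ l → g l ≡ 0) → sumℕ g ≡ 0
  all-zero {zero}  g g≡0 = refl
  all-zero {suc m} g g≡0 = cong₂ _+_ (g≡0 zero) (all-zero (g ∘ suc) (g≡0 ∘ suc))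
sum-single {suc n} f (suc k) f≡0 =
  cong₂ _+_ (f≡0 zero λ ()) (sum-single (f ∘ suc) k λ l l≢k → f≡0 (suc l) (l≢k ∘ Fin.suc-injective))

bin-pos⁺ : ∀ {m} → 0 < m → bin m ≡ 1
bin-pos⁺ {suc m} _ = refl

bin-pos⁻ : ∀ {m} → 0 < bin m → 0 < m
bin-pos⁻ {suc m} _ = s≤s z≤n

bin-*-pos⁻ : ∀ a b → 0 < bin a * bin b → 0 < a × 0 < b
bin-*-pos⁻ a b q with r , s ← *-pos⁻ (bin a) (bin b) q = bin-pos⁻ r , bin-pos⁻ s

I-refl : ∀ (u : Fin n) → 0 < I u u
I-refl u with u Fin.≟ u
... | yes _ = s≤s z≤n
... | no ¬p = contradiction refl ¬p

module _ (M : Matrix n) where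

  -- A positive entry of `M ^ k` means a walk of length `k`; here a walk is cut after `k` steps, the
  -- converse of `^-pos-+`.
  walk-split : ∀ k l u v → 0 < (M ^ (k + l)) u v → ∃ λ w → 0 < (M ^ k) u w × 0 < (M ^ l) w v
  walk-split zero    l u v q = u , I-refl u , q
  walk-split (suc k) l u v q
    with x , r ← sum-pos⁻ _ q
    with r₁ , r₂ ← *-pos⁻ (M u x) _ r
    with w , s , t ← walk-split k l x v r₂
    = w , sum-pos⁺ (λ y → M u y * (M ^ k) y w) x (*-pos⁺ r₁ s) , t

  -- The entry at `u`, `v` counts the vertices at which a walk from `u` to `v` can be after `i`
  -- steps with `j` steps left, that is, the points on one level of an interval.
  Bin-· : ℕ → ℕ → Matrix n
  Bin-· i j = Bin (M ^ i) · Bin (M ^ j)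

  Bin-·-pos⁻ : ∀ i j u v → 0 < Bin-· i j u v → 0 < (M ^ (i + j)) u v
  Bin-·-pos⁻ i j u v q
    with w , r ← sum-pos⁻ _ q
    with r₁ , r₂ ← bin-*-pos⁻ ((M ^ i) u w) _ r
    = ^-pos-+ M i j u w v r₁ r₂

  periodic-pos : ∀ {d γ} → PeriodicFrom M d γ → ∀ t → γ ≤ t → ∀ u v → 0 < (M ^ (t + d)) u v ⇔ 0 < (M ^ t) u v
  periodic-pos per t γ≤t u v = mk⇔
    (λ q → bin-pos⁻ (subst (0 <_) (trans (sym (bin-pos⁺ q)) (per t γ≤t u v)) (s≤s z≤n)))
    (λ q → bin-pos⁻ (subst (0 <_) (trans (sym (bin-pos⁺ q)) (sym (per t γ≤t u v))) (s≤s z≤n)))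

  -- Indecomposability gives a closed walk of positive length, and 0 divides no positive number.
  period-pos : ∀ {d} → Indecomposable M → IsPeriod M d → 0 < d
  period-pos {suc d} _ _ = s≤s z≤n
  period-pos {zero} ind (i , div , _)
    with t , 0<t , q ← ind i i
    with refl ← 0∣⇒≡0 (div t (0<t , q)) = 0<t

  -- With index 0, M is a cyclic permutation matrix, so each of the three products in E 2
  -- contributes 1 at the pair (u, v) joined by the walk of length 2 from u.
  index-zero⇒¬E₂ : Fin n → ∀ {d} → 0 < d → PeriodicFrom M d 0 → ¬ E M 2
  index-zero⇒¬E₂ u {suc d} _ per E₂ = contradiction total λ ()
    where
    -- The period is `suc d` here, so `2 + e` is twice the period. Doubling makes the closed walk
    -- long enough to be cut after two steps even if the period is 1.
    e : ℕ
    e = d + d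
    2d≡2+e : suc d + suc d ≡ 2 + e
    2d≡2+e = cong suc (ℕ.+-suc d d)
    -- Since the index is 0, periodicity reaches down to exponent 0, and `M ^ (2 + e)` has the
    -- support of `I`.
    closed⁻ : ∀ {w x} → 0 < (M ^ (2 + e)) w x → w ≡ x
    closed⁻ {w} {x} q = I-pos w x (Equivalence.to (periodic-pos per 0 z≤n w x)
      (Equivalence.to (periodic-pos per (suc d) z≤n w x) (subst (λ k → 0 < (M ^ k) w x) (sym 2d≡2+e) q)))
    closed⁺ : 0 < (M ^ (2 + e)) u u
    closed⁺ = subst (λ k → 0 < (M ^ k) u u) 2d≡2+e
      (Equivalence.from (periodic-pos per (suc d) z≤n u u) (Equivalence.from (periodic-pos per 0 z≤n u u) (I-refl u)))
    split : ∃ λ v → 0 < (M ^ 2) u v × 0 < (M ^ e) v u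
    split = walk-split 2 e u u closed⁺
    v : Fin n
    v = proj₁ split
    product≡1 : ∀ k l → k + l ≡ 2 → Bin-· k l u v ≡ 1
    product≡1 k l k+l≡2
      with w , q , r ← walk-split k l u v (subst (λ m → 0 < (M ^ m) u v) (sym k+l≡2) (proj₁ (proj₂ split)))
      = trans (sum-single _ w other) (cong₂ _*_ (bin-pos⁺ q) (bin-pos⁺ r))
      where
      open +-*-Solver
      len : l + (e + k) ≡ 2 + e
      len = trans (solve 3 (λ l e k → l :+ (e :+ k) := k :+ l :+ e) refl l e k) (cong (_+ e) k+l≡2)
      -- A second intermediate vertex `x` would give a walk from `x` through `v` and `u` to `w` of
      -- length `l + e + k = 2 + e`, forcing `x ≡ w`.
      other : ∀ x → x ≢ w → Bin (M ^ k) u x * Bin (M ^ l) x v ≡ 0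
      other x x≢w = ℕ.n<1⇒n≡0 (ℕ.≰⇒> λ q′ → x≢w (closed⁻ (subst (λ m → 0 < (M ^ m) x w) len
        (^-pos-+ M l (e + k) x v w (proj₂ (bin-*-pos⁻ ((M ^ k) u x) _ q′)) (^-pos-+ M e k v u w (proj₂ (proj₂ split)) q)))))
    total : 1ℤ ≡ 0ℤ
    total = trans (sym (cong₂ ℤ._+_ (cong (λ x → 1ℤ ℤ.* + x) (product≡1 0 2 refl))
                       (cong₂ ℤ._+_ (cong (λ x → -1ℤ ℤ.* + x) (product≡1 1 1 refl))
                       (cong (λ x → 1ℤ ℤ.* + x ℤ.+ 0ℤ) (product≡1 2 0 refl))))) (E₂ u v)

  -- All powers have the support of `I`, so a walk can only join a vertex to itself. This rules out
  -- `d = 1` in the odd case with index 0.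
  period-one⇒subsingleton : Indecomposable M → PeriodicFrom M 1 0 → ∀ u v → u ≡ v
  period-one⇒subsingleton ind per u v with t , _ , q ← ind u v = descend t q
    where
    descend : ∀ t → 0 < (M ^ t) u v → u ≡ v
    descend zero    q = I-pos u v q
    descend (suc t) q = descend t (Equivalence.to (periodic-pos per t z≤n u v)
      (subst (λ k → 0 < (M ^ k) u v) (ℕ.+-comm 1 t) q))

  -- Propagation of the conditions `E M p` beyond the bound

  module _ {d γ : ℕ} (per : PeriodicFrom M d γ) where

    convolution : ∀ u v → ℕ → ℕ → ℤ
    convolution u v i j = + Bin-· i j u v

    open AlternatingConvolution using (PeriodicInBoth; F-vanishes; F-vanishes-odd)

    convolution-periodic : ∀ u v → PeriodicInBoth (convolution u v) γ d
    convolution-periodic u v =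
      (λ i j γ≤i → cong +_ (sum-cong-≗ ℕ.+-0-monoid λ w → cong (_* Bin (M ^ j) w v) (per i γ≤i u w))) ,
      (λ i j γ≤j → cong +_ (sum-cong-≗ ℕ.+-0-monoid λ w → cong (Bin (M ^ i) u w *_) (per j γ≤j w v)))

    E-step : ∀ p → γ + γ ≤ p → E M p → E M (p + (d + d)) → E M (p + (d + d) + (d + d))
    E-step p 2γ≤p E₁ E₂ u v = F-vanishes (convolution u v) γ (convolution-periodic u v) p 2γ≤p (E₁ u v) (E₂ u v)

    E-step-odd : ¬ 2 ∣ d → ∀ p → γ + γ ≤ p → E M p → E M (p + (d + d))
    E-step-odd odd p 2γ≤p E₁ u v =
      F-vanishes-odd (convolution u v) γ (convolution-periodic u v) odd p 2γ≤p (E₁ u v)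

    -- The value at `p + 4d` comes from those at `p` and `p + 2d`. Positivity of `γ` keeps `p ≥ 2γ`
    -- away from 0, where no condition is available.
    E-all : 0 < d → 0 < γ → (∀ p → 1 ≤ p → p < 2 * γ + 4 * d → E M p) → ∀ p → 1 ≤ p → E M p
    E-all 0<d 0<γ base = stepInduction (E M) (γ + γ) (D + D)
      (λ p 2γ≤p rec → subst (E M) (ℕ.+-assoc p D D) (E-step p 2γ≤p
        (rec p (1≤ 2γ≤p) (ℕ.m<m+n p (ℕ.+-mono-<-≤ 0<D z≤n)))
        (rec (p + D) (ℕ.m≤n⇒m≤n+o D (1≤ 2γ≤p)) (ℕ.+-monoʳ-< p (ℕ.m<m+n D 0<D)))))
      (λ p 1≤p p<b → base p 1≤p (subst (p <_)
        (solve 2 (λ g d → g :+ g :+ (d :+ d :+ (d :+ d)) := con 2 :* g :+ con 4 :* d) refl γ d) p<b))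
      where
      open +-*-Solver
      D : ℕ
      D = d + d
      0<D : 0 < D
      0<D = ℕ.m≤n⇒m≤n+o d 0<d
      1≤ : ∀ {p} → γ + γ ≤ p → 1 ≤ p
      1≤ 2γ≤p = ℕ.≤-trans 0<γ (ℕ.m+n≤o⇒m≤o γ 2γ≤p)

    E-all-odd : 0 < d → 0 < γ → ¬ 2 ∣ d → (∀ p → 1 ≤ p → p < 2 * γ + 2 * d → E M p) → ∀ p → 1 ≤ p → E M p
    E-all-odd 0<d 0<γ odd base = stepInduction (E M) (γ + γ) (d + d)
      (λ p 2γ≤p rec → E-step-odd odd p 2γ≤p
        (rec p (ℕ.≤-trans 0<γ (ℕ.m+n≤o⇒m≤o γ 2γ≤p)) (ℕ.m<m+n p (ℕ.m≤n⇒m≤n+o d 0<d))))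
      (λ p 1≤p p<b → base p 1≤p (subst (p <_)
        (solve 2 (λ g d → g :+ g :+ (d :+ d) := con 2 :* g :+ con 2 :* d) refl γ d) p<b))
      where open +-*-Solver

-- Sums over lists

listSum : ∀ {A : Set} → (A → ℤ) → List A → ℤ
listSum f xs = foldr ℤ._+_ 0ℤ (map f xs)

module _ {A : Set} (f : A → ℤ) where

  listSum-++ : ∀ xs ys → listSum f (xs ++ ys) ≡ listSum f xs ℤ.+ listSum f ys
  listSum-++ []       ys = sym (ℤ.+-identityˡ _)
  listSum-++ (x ∷ xs) ys = trans (cong (ℤ._+_ (f x)) (listSum-++ xs ys)) (sym (ℤ.+-assoc (f x) _ _))

  listSum-filter : ∀ {P : Pred A 0ℓ} (P? : Decidable P) xs →
                   listSum f (filter P? xs) ≡ listSum (λ x → if does (P? x) then f x else 0ℤ) xs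
  listSum-filter P? []       = refl
  listSum-filter P? (x ∷ xs) with P? x
  ... | yes _ = cong (ℤ._+_ (f x)) (listSum-filter P? xs)
  ... | no  _ = trans (listSum-filter P? xs) (sym (ℤ.+-identityˡ _))

  listSum-tabulate : ∀ {m} (g : Fin m → A) → listSum f (tabulate g) ≡ sumℤ (f ∘ g)
  listSum-tabulate {zero}  g = refl
  listSum-tabulate {suc m} g = cong (ℤ._+_ (f (g zero))) (listSum-tabulate (g ∘ suc))

  listSum-cartesianProductWith : ∀ {B C : Set} (g : B → C → A) xs ys →
    listSum f (cartesianProductWith g xs ys) ≡ listSum (λ x → listSum (λ y → f (g x y)) ys) xs
  listSum-cartesianProductWith g []       ys = refl
  listSum-cartesianProductWith g (x ∷ xs) ys = trans
    (listSum-++ (map (g x) ys) (cartesianProductWith g xs ys))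
    (cong₂ ℤ._+_ (cong (foldr ℤ._+_ 0ℤ) (sym (map-∘ ys))) (listSum-cartesianProductWith g xs ys))

  -- Duplicate-free lists with the same members are permutations of each other. Hence the sum over
  -- an interval does not depend on the listing that `IsEulerian` happens to supply.
  listSum-unique : ∀ {xs ys} → Unique xs → Unique ys → (∀ {z} → z ∈ xs ⇔ z ∈ ys) → listSum f xs ≡ listSum f ys
  listSum-unique xs! ys! xs⇔ys =
    ↭ₛ.foldr-commMonoid (setoid ℤ) ℤ.+-0-isCommutativeMonoid
      (↭⇒↭ₛ (↭.map⁺ f (∼bag⇒↭ (unique∧set⇒bag xs! ys! xs⇔ys))))

+-sumℕ : ∀ (f : Fin n → ℕ) → + sumℕ f ≡ sumℤ (λ k → + f k)
+-sumℕ {zero}  f = refl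
+-sumℕ {suc n} f = trans (ℤ.pos-+ (f zero) _) (cong (ℤ._+_ (+ f zero)) (+-sumℕ (f ∘ suc)))

sumℤ-*ˡ : ∀ x (f : Fin n → ℤ) → sumℤ (λ k → x ℤ.* f k) ≡ x ℤ.* sumℤ f
sumℤ-*ˡ x f = sym (*-distribˡ-sum ℤ.+-*-semiring x f)

sumℤ-cong : ∀ {f g : Fin n → ℤ} → (∀ k → f k ≡ g k) → sumℤ f ≡ sumℤ g
sumℤ-cong = sum-cong-≗ ℤ.+-0-monoid

sign-suc : ∀ i → sign (ℤ.suc i) ≡ -1ℤ ℤ.* sign i
sign-suc (+ m)          = refl
sign-suc -[1+ zero ]    = refl
-- Below zero the successor has smaller absolute value, so the two factors -1 on the right have to
-- cancel.
sign-suc -[1+ (suc m) ] = trans (sym (ℤ.*-identityˡ (sign -[1+ m ]))) (ℤ.*-assoc -1ℤ -1ℤ (sign -[1+ m ]))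

sign-+ : ∀ i k → sign (i ℤ.+ + k) ≡ sign i ℤ.* -1ℤ ℤ.^ k
sign-+ i zero    = trans (cong sign (ℤ.+-identityʳ i)) (sym (ℤ.*-identityʳ (sign i)))
sign-+ i (suc k) = begin
  sign (i ℤ.+ + suc k)                ≡⟨ cong sign (sym (ℤ.+-assoc i 1ℤ (+ k))) ⟩
  sign (i ℤ.+ 1ℤ ℤ.+ + k)             ≡⟨ sign-+ (i ℤ.+ 1ℤ) k ⟩
  sign (i ℤ.+ 1ℤ) ℤ.* -1ℤ ℤ.^ k       ≡⟨ cong (λ j → sign j ℤ.* -1ℤ ℤ.^ k) (ℤ.+-comm i 1ℤ) ⟩
  sign (ℤ.suc i) ℤ.* -1ℤ ℤ.^ k        ≡⟨ cong (ℤ._* -1ℤ ℤ.^ k) (trans (sign-suc i) (ℤ.*-comm -1ℤ (sign i))) ⟩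
  sign i ℤ.* -1ℤ ℤ.* -1ℤ ℤ.^ k        ≡⟨ ℤ.*-assoc (sign i) -1ℤ (-1ℤ ℤ.^ k) ⟩
  sign i ℤ.* -1ℤ ℤ.^ suc k            ∎
  where open ≡-Reasoning

-- Lying in an interval amounts to two positivity conditions; their joint indicator is a product of
-- two `bin`s, which is a summand of a matrix product.
if-bin : ∀ {P : Set} (P? : Dec P) s a b → P ⇔ (0 < a × 0 < b) →
         (if does P? then s else 0ℤ) ≡ s ℤ.* + (bin a * bin b)
if-bin (yes p) s a b P⇔ with q , r ← Equivalence.to P⇔ p rewrite bin-pos⁺ q | bin-pos⁺ r = sym (ℤ.*-identityʳ s)
if-bin (no ¬p) s zero    b       P⇔ = sym (ℤ.*-zeroʳ s)
if-bin (no ¬p) s (suc a) zero    P⇔ = sym (ℤ.*-zeroʳ s)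
if-bin (no ¬p) s (suc a) (suc b) P⇔ = contradiction (Equivalence.from P⇔ (s≤s z≤n , s≤s z≤n)) ¬p

-- Intervals of the level poset

i≤j⇒j≡i+k : ∀ {i j} → i ℤ.≤ j → ∃ λ k → j ≡ i ℤ.+ + k
i≤j⇒j≡i+k {i} {j} i≤j = ∣ j ℤ.- i ∣ , (begin
  j                        ≡⟨ i+[j-i]≡j ⟨
  i ℤ.+ (j ℤ.- i)          ≡⟨ cong (ℤ._+_ i) (ℤ.0≤i⇒+∣i∣≡i (ℤ.i≤j⇒0≤j-i i≤j)) ⟨
  i ℤ.+ + ∣ j ℤ.- i ∣      ∎)
  where
  open ≡-Reasoning
  i+[j-i]≡j : i ℤ.+ (j ℤ.- i) ≡ j
  i+[j-i]≡j = trans (ℤ.+-comm i _) (trans (ℤ.+-assoc j (ℤ.- i) i)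
    (trans (cong (ℤ._+_ j) (ℤ.+-inverseˡ i)) (ℤ.+-identityʳ j)))

[i+k]-i≡k : ∀ i k → (i ℤ.+ k) ℤ.- i ≡ k
[i+k]-i≡k i k = trans (cong (ℤ._- i) (ℤ.+-comm i k)) (trans (ℤ.+-assoc k i (ℤ.- i))
  (trans (cong (ℤ._+_ k) (ℤ.+-inverseʳ i)) (ℤ.+-identityʳ k)))

+-cancelˡ-≡ : ∀ i {j k} → i ℤ.+ j ≡ i ℤ.+ k → j ≡ k
+-cancelˡ-≡ i {j} {k} eq = trans (sym ([i+k]-i≡k i j)) (trans (cong (ℤ._- i) eq) ([i+k]-i≡k i k))

+-cancelˡ-≤ : ∀ i {j k} → i ℤ.+ j ℤ.≤ i ℤ.+ k → j ℤ.≤ k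
+-cancelˡ-≤ i {j} {k} le = subst₂ ℤ._≤_ ([i+k]-i≡k i j) ([i+k]-i≡k i k) (ℤ.+-monoˡ-≤ (ℤ.- i) le)

module _ (M : Matrix n) where

  open Poset (levelPoset M) using () renaming (_≤_ to _≼_; trans to ≼-trans; refl to ≼-refl)

  _≼?_ : ∀ x y → Dec (x ≼ y)
  (u , i) ≼? (v , j) =
    (i ℤ.<? j ×-dec 0 ℕ.<? (M ^ ∣ j ℤ.- i ∣) u v) ⊎-dec ≡-dec Fin._≟_ ℤ._≟_ (u , i) (v , j)

  Between : Fin n × ℤ → Fin n × ℤ → Pred (Fin n × ℤ) _
  Between x y z = x ≼ z × z ≼ y

  between? : ∀ x y → Decidable (Between x y)
  between? x y z = x ≼? z ×-dec z ≼? y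

  ≼⇒level≤ : ∀ {x y} → x ≼ y → proj₂ x ℤ.≤ proj₂ y
  ≼⇒level≤ (inj₁ (i<j , _)) = ℤ.<⇒≤ i<j
  ≼⇒level≤ (inj₂ refl)      = ℤ.≤-refl

  -- The strict order covers `k > 0`, and `M ^ 0 = I` accounts for equality, so the reflexive order
  -- needs no separate case afterwards.
  ≼⇔walk : ∀ i k u w → (u , i) ≼ (w , i ℤ.+ + k) ⇔ 0 < (M ^ k) u w
  ≼⇔walk i k u w = mk⇔ to (from k)
    where
    length : ∀ k → ∣ (i ℤ.+ + k) ℤ.- i ∣ ≡ k
    length k = cong ∣_∣ ([i+k]-i≡k i (+ k))
    to : (u , i) ≼ (w , i ℤ.+ + k) → 0 < (M ^ k) u w
    to (inj₁ (_ , q)) = subst (λ e → 0 < (M ^ e) u w) (length k) q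
    to (inj₂ eq) with u≡w , i≡i+k ← ,-injective eq =
      subst₂ (λ e v → 0 < (M ^ e) u v) 0≡k u≡w (I-refl u)
      where
      0≡k : 0 ≡ k
      0≡k = trans (cong ∣_∣ (sym (ℤ.+-inverseʳ i))) (trans (cong (λ j → ∣ j ℤ.- i ∣) i≡i+k) (length k))
    from : ∀ k → 0 < (M ^ k) u w → (u , i) ≼ (w , i ℤ.+ + k)
    from zero    q = inj₂ (cong₂ _,_ (I-pos u w q) (sym (ℤ.+-identityʳ i)))
    from (suc k) q = inj₁
      ( subst (ℤ._< i ℤ.+ + suc k) (ℤ.+-identityʳ i) (ℤ.+-monoʳ-< i (ℤ.+<+ (s≤s z≤n)))
      , subst (λ e → 0 < (M ^ e) u w) (sym (length (suc k))) q)

  between⇔walks : ∀ u v w i p k → k ≤ p →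
    Between (u , i) (v , i ℤ.+ + p) (w , i ℤ.+ + k) ⇔ (0 < (M ^ k) u w × 0 < (M ^ (p ∸ k)) w v)
  between⇔walks u v w i p k k≤p = mk⇔
    (λ (x≼z , z≼y) → to₁ x≼z , to₂ (subst (λ j → (w , i ℤ.+ + k) ≼ (v , j)) end z≼y))
    (λ (q , r) → from₁ q , subst (λ j → (w , i ℤ.+ + k) ≼ (v , j)) (sym end) (from₂ r))
    where
    open Equivalence (≼⇔walk i k u w) renaming (to to to₁; from to from₁) using ()
    open Equivalence (≼⇔walk (i ℤ.+ + k) (p ∸ k) w v) renaming (to to to₂; from to from₂) using ()
    end : i ℤ.+ + p ≡ (i ℤ.+ + k) ℤ.+ + (p ∸ k)
    end = trans (cong (λ q → i ℤ.+ + q) (sym (ℕ.m+[n∸m]≡n k≤p)))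
      (trans (cong (ℤ._+_ i) (ℤ.pos-+ k (p ∸ k))) (sym (ℤ.+-assoc i _ _)))

  module _ (u v : Fin n) (i : ℤ) (p : ℕ) where

    private
      x y : Fin n × ℤ
      x = u , i
      y = v , i ℤ.+ + p

    point : Fin (suc p) → Fin n → Fin n × ℤ
    point k w = w , i ℤ.+ + toℕ k

    -- The order respects levels, so these `p + 1` full levels contain the whole interval.
    points : List (Fin n × ℤ)
    points = cartesianProductWith point (allFin (suc p)) (allFin n)

    intervalList : List (Fin n × ℤ)
    intervalList = filter (between? x y) points

    intervalList-unique : Unique intervalList
    intervalList-unique = Unique.filter⁺ (between? x y)
      (Unique.cartesianProductWith⁺ point point-injective (Unique.allFin⁺ (suc p)) (Unique.allFin⁺ n))
      where
      point-injective : ∀ {k w l w′} → point k w ≡ point l w′ → k ≡ l × w ≡ w′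
      point-injective eq with w≡w′ , i+k≡i+l ← ,-injective eq =
        Fin.toℕ-injective (ℤ.+-injective (+-cancelˡ-≡ i i+k≡i+l)) , w≡w′

    ∈-intervalList⇔ : ∀ z → z ∈ intervalList ⇔ Between x y z
    ∈-intervalList⇔ z = mk⇔ (λ z∈ → proj₂ (∈-filter⁻ (between? x y) {xs = points} z∈)) (from z)
      where
      from : ∀ z → Between x y z → z ∈ intervalList
      from (w , l) (x≼z , z≼y) with k , refl ← i≤j⇒j≡i+k (≼⇒level≤ x≼z) =
        ∈-filter⁺ (between? x y)
          (subst (λ m → (w , i ℤ.+ + m) ∈ points) (Fin.toℕ-fromℕ< k<1+p)
            (∈-cartesianProductWith⁺ point (∈-allFin (fromℕ< k<1+p)) (∈-allFin w)))
          (x≼z , z≼y)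
        where
        k<1+p : k < suc p
        k<1+p = s≤s (ℤ.drop‿+≤+ (+-cancelˡ-≤ i (≼⇒level≤ z≼y)))

    -- The level `i + k` holds `Bin-· M k (p ∸ k) u v` points of the interval, each of sign `sign i`
    -- times the `k`-th power of -1.
    intervalList-sum : listSum (sign ∘ proj₂) intervalList ≡
      sign i ℤ.* sumℤ {suc p} (λ k → (-1ℤ ℤ.^ toℕ k) ℤ.* + Bin-· M (toℕ k) (p ∸ toℕ k) u v)
    intervalList-sum = begin
      listSum (sign ∘ proj₂) intervalList
        ≡⟨ listSum-filter (sign ∘ proj₂) (between? x y) points ⟩
      listSum weight points
        ≡⟨ listSum-cartesianProductWith weight point (allFin (suc p)) (allFin n) ⟩
      listSum (λ k → listSum (weight ∘ point k) (allFin n)) (allFin (suc p))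
        ≡⟨ listSum-tabulate (λ k → listSum (weight ∘ point k) (allFin n)) id ⟩
      sumℤ {suc p} (λ k → listSum (weight ∘ point k) (allFin n))
        ≡⟨ sumℤ-cong {suc p} level-sum ⟩
      sumℤ {suc p} (λ k → sign i ℤ.* ((-1ℤ ℤ.^ toℕ k) ℤ.* + Bin-· M (toℕ k) (p ∸ toℕ k) u v))
        ≡⟨ sumℤ-*ˡ {suc p} (sign i) (λ k → (-1ℤ ℤ.^ toℕ k) ℤ.* + Bin-· M (toℕ k) (p ∸ toℕ k) u v) ⟩
      sign i ℤ.* sumℤ {suc p} (λ k → (-1ℤ ℤ.^ toℕ k) ℤ.* + Bin-· M (toℕ k) (p ∸ toℕ k) u v) ∎
      where
      open ≡-Reasoning
      weight : Fin n × ℤ → ℤ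
      weight z = if does (between? x y z) then sign (proj₂ z) else 0ℤ
      level-sum : ∀ k → listSum (weight ∘ point k) (allFin n) ≡
        sign i ℤ.* ((-1ℤ ℤ.^ toℕ k) ℤ.* + Bin-· M (toℕ k) (p ∸ toℕ k) u v)
      level-sum k = begin
        listSum (weight ∘ point k) (allFin n)
          ≡⟨ listSum-tabulate (weight ∘ point k) id ⟩
        sumℤ (weight ∘ point k)
          ≡⟨ sumℤ-cong (λ w → if-bin (between? x y (point k w)) s ((M ^ toℕ k) u w) ((M ^ (p ∸ toℕ k)) w v)
               (between⇔walks u v w i p (toℕ k) (ℕ.≤-pred (Fin.toℕ<n k)))) ⟩
        sumℤ (λ w → s ℤ.* + (Bin (M ^ toℕ k) u w * Bin (M ^ (p ∸ toℕ k)) w v))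
          ≡⟨ sumℤ-*ˡ s (λ w → + (Bin (M ^ toℕ k) u w * Bin (M ^ (p ∸ toℕ k)) w v)) ⟩
        s ℤ.* sumℤ (λ w → + (Bin (M ^ toℕ k) u w * Bin (M ^ (p ∸ toℕ k)) w v))
          ≡⟨ cong (ℤ._*_ s) (+-sumℕ (λ w → Bin (M ^ toℕ k) u w * Bin (M ^ (p ∸ toℕ k)) w v)) ⟨
        s ℤ.* + Bin-· M (toℕ k) (p ∸ toℕ k) u v
          ≡⟨ cong (ℤ._* + Bin-· M (toℕ k) (p ∸ toℕ k) u v) (sign-+ i (toℕ k)) ⟩
        sign i ℤ.* (-1ℤ ℤ.^ toℕ k) ℤ.* + Bin-· M (toℕ k) (p ∸ toℕ k) u v
          ≡⟨ ℤ.*-assoc (sign i) (-1ℤ ℤ.^ toℕ k) _ ⟩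
        sign i ℤ.* ((-1ℤ ℤ.^ toℕ k) ℤ.* + Bin-· M (toℕ k) (p ∸ toℕ k) u v) ∎
        where s = sign (i ℤ.+ + toℕ k)

  -- From Eulerian intervals to `E M p`

  listSum-proj₁ : ∀ {Q : Pred (Fin n × ℤ) 0ℓ} (zs : List (∃ Q)) →
                  listSum (sign ∘ proj₂ ∘ proj₁) zs ≡ listSum (sign ∘ proj₂) (map proj₁ zs)
  listSum-proj₁ zs = cong (foldr ℤ._+_ 0ℤ) (map-∘ zs)

  -- If no walk of length `p` leads from `u` to `v`, there is no interval to use, but then every
  -- product vanishes at this entry. Otherwise the Eulerian condition is applied to the full
  -- interval from level 0 to level `p`.
  levelEulerian⇒E : LevelEulerian M → ∀ p → 1 ≤ p → E M p
  levelEulerian⇒E eulerianIntervals p 1≤p u v with 0 ℕ.<? (M ^ p) u v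
  ... | no ¬q = trans (sumℤ-cong {suc p} term≡0) (sum-replicate-zero ℤ.+-0-monoid (suc p))
    where
    term≡0 : ∀ k → (-1ℤ ℤ.^ toℕ k) ℤ.* + Bin-· M (toℕ k) (p ∸ toℕ k) u v ≡ 0ℤ
    term≡0 k = trans (cong (λ m → (-1ℤ ℤ.^ toℕ k) ℤ.* + m) (ℕ.n<1⇒n≡0 (ℕ.≰⇒> λ r → ¬q
      (subst (λ m → 0 < (M ^ m) u v) (ℕ.m+[n∸m]≡n (ℕ.≤-pred (Fin.toℕ<n k)))
        (Bin-·-pos⁻ M (toℕ k) (p ∸ toℕ k) u v r))))) (ℤ.*-zeroʳ (-1ℤ ℤ.^ toℕ k))
  ... | yes q = begin
    S                                            ≡⟨ ℤ.*-identityˡ S ⟨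
    sign 0ℤ ℤ.* S                                ≡⟨ intervalList-sum u v 0ℤ p ⟨
    -- Equality in the interval poset compares first components only, so projecting `zs` preserves
    -- uniqueness.
    listSum (sign ∘ proj₂) L                     ≡⟨ listSum-unique (sign ∘ proj₂) (AllPairs.map⁺ zs!) L! same ⟨
    listSum (sign ∘ proj₂) (map proj₁ zs)        ≡⟨ listSum-proj₁ zs ⟨
    listSum (sign ∘ proj₂ ∘ proj₁) zs            ≡⟨ zs-sum ⟩
    0ℤ                                           ∎
    where
    open ≡-Reasoning
    S : ℤ
    S = sumℤ {suc p} (λ k → (-1ℤ ℤ.^ toℕ k) ℤ.* + Bin-· M (toℕ k) (p ∸ toℕ k) u v)
    L = intervalList u v 0ℤ p
    L! = intervalList-unique u v 0ℤ p
    x y : Fin n × ℤ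
    x = u , 0ℤ
    y = v , 0ℤ ℤ.+ + p
    x≼y : x ≼ y
    x≼y = Equivalence.from (≼⇔walk 0ℤ p u v) q
    listing = IsEulerian.eulerian (eulerianIntervals x y x≼y) (x , ≼-refl , x≼y) (y , x≼y , ≼-refl) x≼y
                (subst (1ℤ ℤ.≤_) (sym ([i+k]-i≡k 0ℤ (+ p))) (ℤ.+≤+ 1≤p))
    zs = proj₁ listing
    zs! = proj₁ (proj₁ (proj₂ listing))
    zs-∈ = proj₂ (proj₁ (proj₂ listing))
    zs-sum = proj₂ (proj₂ listing)
    same : ∀ {z} → z ∈ map proj₁ zs ⇔ z ∈ L
    same {z} = mk⇔
      (λ z∈zs → let w , w∈zs , z≡w = ∈-map⁻ proj₁ z∈zs in
        Equivalence.from (∈-intervalList⇔ u v 0ℤ p z) (subst (Between x y) (sym z≡w) (proj₂ w)))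
      (λ z∈L → let b = Equivalence.to (∈-intervalList⇔ u v 0ℤ p z) z∈L in
        Any.map⁺ (Equivalence.from (zs-∈ (z , b)) b))

  -- From `E M p` to Eulerian intervals

  map-proj₁-toList : ∀ {Q : Pred (Fin n × ℤ) 0ℓ} {zs} (qs : All Q zs) → map proj₁ (All.toList qs) ≡ zs
  map-proj₁-toList []       = refl
  map-proj₁-toList (_ ∷ qs) = cong (_ ∷_) (map-proj₁-toList qs)

  -- The vertex after the first step of the walk lies strictly between its ends. Hence a cover
  -- relation cannot raise the level by two or more.
  ⊏-between : ∀ i k u v → 0 < (M ^ (2 + k)) u v →
              ∃ λ z → _⊏_ M (u , i) z × _⊏_ M z (v , i ℤ.+ + (2 + k))
  ⊏-between i k u v q with w , r , s ← walk-split M 1 (suc k) u v q =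
    (w , i ℤ.+ 1ℤ) , strict i 0 r ,
    subst (λ j → _⊏_ M (w , i ℤ.+ 1ℤ) (v , j)) (ℤ.+-assoc i 1ℤ (+ suc k)) (strict (i ℤ.+ 1ℤ) k s)
    where
    strict : ∀ {u v} i k → 0 < (M ^ suc k) u v → _⊏_ M (u , i) (v , i ℤ.+ + suc k)
    strict {u} {v} i k q with Equivalence.from (≼⇔walk i (suc k) u v) q
    ... | inj₁ u⊏v = u⊏v
    ... | inj₂ eq with () ← +-cancelˡ-≡ i (trans (ℤ.+-identityʳ i) (proj₂ (,-injective eq)))

  module _ (allE : ∀ p → 1 ≤ p → E M p) (x y : Fin n × ℤ) (x≼y : x ≼ y) where

    private
      P = intervalPoset (levelPoset M) x y
      rank : Poset.Carrier P → ℤ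
      rank = level M ∘ proj₁

    -- The positive-rank assumption guards only the vanishing of the sum: the listing itself also
    -- serves `finite`, where the interval may be a single point.
    intervalListing : ∀ a b → Poset._≤_ P a b →
      ∃ λ zs → ListsInterval P rank a b zs × (1ℤ ℤ.≤ rank b ℤ.- rank a → alternatingSum P rank zs ≡ 0ℤ)
    intervalListing ((u , i) , x≼a , a≼y) ((v , j) , x≼b , b≼y) a≼b
      with p , refl ← i≤j⇒j≡i+k (≼⇒level≤ a≼b) =
      zs , (AllPairs.map⁻ (subst Unique (sym map-zs) (intervalList-unique u v i p)) , member) , sum
      where
      L = intervalList u v i p
      inside : All (Between x y) L
      inside = All.tabulate λ {z} z∈L →
        let a≼z , z≼b = Equivalence.to (∈-intervalList⇔ u v i p z) z∈L in ≼-trans x≼a a≼z , ≼-trans z≼b b≼y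
      zs : List (∃ (Between x y))
      zs = All.toList inside
      map-zs : map proj₁ zs ≡ L
      map-zs = map-proj₁-toList inside
      member : ∀ z → _ ⇔ Between (u , i) (v , i ℤ.+ + p) (proj₁ z)
      member z = mk⇔
        (λ z∈zs → Equivalence.to (∈-intervalList⇔ u v i p (proj₁ z)) (subst (proj₁ z ∈_) map-zs (Any.map⁺ z∈zs)))
        (λ b → Any.map⁻ (subst (proj₁ z ∈_) (sym map-zs) (Equivalence.from (∈-intervalList⇔ u v i p (proj₁ z)) b)))
      sum : 1ℤ ℤ.≤ (i ℤ.+ + p) ℤ.- i → alternatingSum P rank zs ≡ 0ℤ
      sum 1≤r = begin
        listSum (sign ∘ proj₂ ∘ proj₁) zs      ≡⟨ listSum-proj₁ zs ⟩
        listSum (sign ∘ proj₂) (map proj₁ zs)  ≡⟨ cong (listSum (sign ∘ proj₂)) map-zs ⟩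
        listSum (sign ∘ proj₂) L               ≡⟨ intervalList-sum u v i p ⟩
        sign i ℤ.* _                           ≡⟨ cong (ℤ._*_ (sign i)) (allE p 1≤p u v) ⟩
        sign i ℤ.* 0ℤ                          ≡⟨ ℤ.*-zeroʳ (sign i) ⟩
        0ℤ                                     ∎
        where
        open ≡-Reasoning
        1≤p : 1 ≤ p
        1≤p = ℤ.drop‿+≤+ (subst (1ℤ ℤ.≤_) ([i+k]-i≡k i (+ p)) 1≤r)

    rank-cover : ∀ a b → _⋖_ P rank a b → rank b ≡ ℤ.suc (rank a)
    rank-cover ((u , i) , x≼a , a≼y) ((v , j) , x≼b , b≼y) ((a≼b , a≢b) , none)
      with k , refl ← i≤j⇒j≡i+k (≼⇒level≤ a≼b) = go k a≼b a≢b b≼y none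
      where
      go : ∀ k → (u , i) ≼ (v , i ℤ.+ + k) → (u , i) ≢ (v , i ℤ.+ + k) → (v , i ℤ.+ + k) ≼ y →
           ¬ (∃ λ z → ((u , i) ≼ proj₁ z × (u , i) ≢ proj₁ z) × (proj₁ z ≼ (v , i ℤ.+ + k) × proj₁ z ≢ (v , i ℤ.+ + k))) →
           i ℤ.+ + k ≡ ℤ.suc i
      go zero a≼b a≢b _ _ = contradiction
        (cong₂ _,_ (I-pos u v (Equivalence.to (≼⇔walk i 0 u v) a≼b)) (sym (ℤ.+-identityʳ i))) a≢b
      go (suc zero) _ _ _ _ = ℤ.+-comm i 1ℤ
      go (suc (suc k)) a≼b _ b≼y none
        with z , a⊏z , z⊏b ← ⊏-between i k u v (Equivalence.to (≼⇔walk i (2 + k) u v) a≼b)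
        = contradiction
            ((z , ≼-trans x≼a (inj₁ a⊏z) , ≼-trans (inj₁ z⊏b) b≼y) , (inj₁ a⊏z , ⊏⇒≢ a⊏z) , (inj₁ z⊏b , ⊏⇒≢ z⊏b))
            none
        where
        ⊏⇒≢ : ∀ {x y} → _⊏_ M x y → x ≢ y
        ⊏⇒≢ (i<j , _) refl = ℤ.<-irrefl refl i<j

    interval-isEulerian : IsEulerian P rank
    interval-isEulerian = record
      { finite         = let zs , (_ , member) , _ = intervalListing (x , ≼-refl , x≼y) (y , x≼y , ≼-refl) x≼y
                         in zs , λ z → Equivalence.from (member z) (proj₂ z)
      ; minimum        = (x , ≼-refl , x≼y) , λ z → proj₁ (proj₂ z)
      ; maximum        = (y , x≼y , ≼-refl) , λ z → proj₂ (proj₂ z)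
      ; isRankFunction = record
        { rank-cong = cong proj₂
        ; rank-mono = λ { (inj₁ (i<j , _) , _) → i<j ; (inj₂ a≡b , a≢b) → contradiction a≡b a≢b }
        ; rank-⋖    = λ {a} {b} → rank-cover a b
        }
      ; eulerian       = λ a b a≼b 1≤r → let zs , listing , sum = intervalListing a b a≼b in zs , listing , sum 1≤r
      }

theorem4p3 : ∀ (n : ℕ) .{{_ : NonZero n}} (M : Matrix n) (d γ : ℕ) →
    IsBinary M → Indecomposable M → IsPeriod M d → IsIndex M d γ →
    (LevelEulerian M ⇔ (∀ p → 1 ≤ p → p < 2 * γ + 4 * d → E M p))
    -- The improved bound fails for the 1 × 1 matrix (1), where d = 1 and γ = 0:
    -- the level poset is the chain ℤ, which violates E 2 but not E 1.
    × (¬ (2 ∣ d) → n ≢ 1 →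
       (LevelEulerian M ⇔ (∀ p → 1 ≤ p → p < 2 * γ + 2 * d → E M p)))
theorem4p3 n@(suc m) M d γ _ ind period (per , _) =
  mk⇔ (λ le p 1≤p _ → levelEulerian⇒E M le p 1≤p) (λ base → interval-isEulerian M (all γ per base)) ,
  λ odd n≢1 → mk⇔ (λ le p 1≤p _ → levelEulerian⇒E M le p 1≤p)
                  (λ base → interval-isEulerian M (all-odd γ per odd n≢1 base))
  where
  0<d : 0 < d
  0<d = period-pos M ind period
  all : ∀ γ → PeriodicFrom M d γ → (∀ p → 1 ≤ p → p < 2 * γ + 4 * d → E M p) → ∀ p → 1 ≤ p → E M p
  -- For index 0 the bound is `4d ≥ 4`, so `E M 2` is among the hypotheses.
  all zero per base = contradiction (base 2 (s≤s z≤n) (ℕ.<-≤-trans (s≤s (s≤s (s≤s z≤n))) (ℕ.*-monoʳ-≤ 4 0<d)))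
    (index-zero⇒¬E₂ M zero 0<d per)
  all (suc γ) per base = E-all M per 0<d (s≤s z≤n) base
  all-odd : ∀ γ → PeriodicFrom M d γ → ¬ 2 ∣ d → n ≢ 1 →
            (∀ p → 1 ≤ p → p < 2 * γ + 2 * d → E M p) → ∀ p → 1 ≤ p → E M p
  all-odd (suc γ) per odd _ base = E-all-odd M per 0<d (s≤s z≤n) odd base
  -- Here the bound is only `2d`, which exceeds 2 once `d = 1` is excluded by `n ≢ 1`.
  all-odd zero per odd n≢1 base = contradiction
    (base 2 (s≤s z≤n) (ℕ.<-≤-trans (s≤s (s≤s (s≤s z≤n))) (ℕ.*-monoʳ-≤ 2 1<d)))
    (index-zero⇒¬E₂ M zero 0<d per)
    where
    subsingleton⇒≡1 : ∀ m → (∀ (u v : Fin (suc m)) → u ≡ v) → suc m ≡ 1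
    subsingleton⇒≡1 zero    _   = refl
    subsingleton⇒≡1 (suc m) u≡v with () ← u≡v zero (suc zero)
    1<d : 1 < d
    1<d = ℕ.≤∧≢⇒< 0<d λ 1≡d → n≢1 (subsingleton⇒≡1 m
      (period-one⇒subsingleton M ind (subst (λ e → PeriodicFrom M e 0) (sym 1≡d) per)))
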